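{- Let $n \in \mathbb{N}$ and let $J_n(1)$ be the finite Jaco graph on vertices $v_1, \dots, v_n$, with prime Jaconian vertex $v_i$. Then $$b_r(J_n(1)) = \sum_{j=1}^{i}\bigl(d^+(v_j) - d^-(v_j)\bigr) + \sum_{j=i+1}^{n}\max\{0, (n-j) - d^-(v_j)\},$$ where $d^+(v_j)$ and $d^-(v_j)$ denote the out-degree and in-degree of $v_j$ in $J_n(1)$ with its defining orientation.
   Context: Infinite Jaco graph $J_\infty(1)$: the directed graph with vertex set $\{v_k : k \in \mathbb{N}\}$ (with $\mathbb{N}=\{1,2,3,\dots\}$), in which every arc goes from a lower-indexed vertex to a higher-indexed one. For $k<\ell$, the arc $(v_k, v_\ell)$ is present if and only if $2k - d^-(v_k) \geq \ell$. Here $d^-(v_k)$ is the in-degree of $v_k$; it depends only on arcs from vertices of smaller index, so the arcs are determined recursively. The finite Jaco graph $J_n(1)$ is the subgraph of $J_\infty(1)$ induced on $v_1, \dots, v_n$, keeping the orientation of its arcs. Let $\Delta(J_n(1))$ be the maximum degree (in-degree plus out-degree) in $J_n(1)$. The prime Jaconian vertex of $J_n(1)$ is the vertex of smallest index whose degree equals $\Delta(J_n(1))$. Brush number. For a finite simple graph, all edges are initially dirty, and each vertex is initially allocated a nonnegative number of brushes. The cleaning process repeatedly takes a vertex whose number of brushes is at least the number of dirty edges incident to it. That vertex sends one brush along each of its incident dirty edges. Each such edge becomes clean, and the neighbour at its other end gains one brush. The brush number $b_r(G)$ of the underlying undirected graph $G$ is the minimum total number of brushes, over all initial allocations, for which every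 edge can eventually be cleaned. Equivalently, $b_r(G) = \min_{\alpha} \sum_{v} \max\{0, d^+_\alpha(v) - d^-_\alpha(v)\}$, where the minimum is over all orientations $\alpha$ of $G$ in which cleaning is possible (the acyclic orientations), and orientations where cleaning is impossible are assigned value $\infty$. Here $b_r(J_n(1))$ means the brush number of the underlying undirected graph of $J_n(1)$. -}

module Defs where

open import Data.Bool using (Bool; true; false; _∧_; _∨_; if_then_else_)
open import Data.Nat using (ℕ; zero; suc; _+_; _*_; _∸_; _≤_; _<_; _⊔_; _≤ᵇ_; _<ᵇ_)
open import Data.Fin using (Fin; toℕ; _≟_)
open import Data.List using (List; []; _∷_; _++_; map; upTo; allFin; foldr)
open import Data.Nat.ListAction using (sum)
open import Data.Integer as ℤ using (ℤ; +_)
open import Data.Product using (Σ; ∃; _×_; _,_)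
open import Relation.Nullary using (¬_; yes; no)
open import Relation.Binary.PropositionalEquality using (_≡_)
open import Relation.Binary.Construct.Closure.ReflexiveTransitive using (Star)

countᵇ : {A : Set} → (A → Bool) → List A → ℕ
countᵇ p []       = 0
countᵇ p (x ∷ xs) = (if p x then 1 else 0) + countᵇ p xs

range : ℕ → List ℕ
range n = map suc (upTo n)

-- Infinite Jaco graph J_∞(1)
-- Vertices are v_k, k ≥ 1 (index 0 is unused junk).

-- arcsInto ℓ j [d_j, d_{j+1}, ...] counts the vertices v_m (m = j, j+1, ...)
-- with an arc (v_m, v_ℓ), i.e. with ℓ ≤ 2m - d⁻(v_m).
arcsInto : ℕ → ℕ → List ℕ → ℕ
arcsInto ℓ j []       = 0
arcsInto ℓ j (d ∷ ds) = (if ℓ ≤ᵇ (2 * j ∸ d) then 1 else 0) + arcsInto ℓ (suc j) ds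

-- inDegs m = [d⁻(v_1), ..., d⁻(v_m)] in J_∞(1)  (only arcs v_j → v_m with j < m;
-- the condition k < ℓ is automatic here since j ranges over 1..m)
inDegs : ℕ → List ℕ
inDegs zero    = []
inDegs (suc m) = inDegs m ++ (arcsInto (suc m) 1 (inDegs m) ∷ [])

indeg∞ : ℕ → ℕ
indeg∞ zero    = 0
indeg∞ (suc m) = arcsInto (suc m) 1 (inDegs m)

arcᵇ : ℕ → ℕ → Bool
arcᵇ k ℓ = (1 ≤ᵇ k) ∧ ((k <ᵇ ℓ) ∧ (ℓ ≤ᵇ (2 * k ∸ indeg∞ k)))

outdeg : ℕ → ℕ → ℕ
outdeg n k = countᵇ (λ ℓ → arcᵇ k ℓ) (range n)

indeg : ℕ → ℕ → ℕ
indeg n k = countᵇ (λ j → arcᵇ j k) (range n)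

deg : ℕ → ℕ → ℕ
deg n k = indeg n k + outdeg n k

Δ : ℕ → ℕ
Δ n = foldr _⊔_ 0 (map (deg n) (range n))

IsPrimeJaconian : ℕ → ℕ → Set
IsPrimeJaconian n i =
  (1 ≤ i) × (i ≤ n) × (deg n i ≡ Δ n) ×
  (∀ j → 1 ≤ j → j < i → ¬ (deg n j ≡ Δ n))

record Graph : Set where
  field
    V   : ℕ
    adj : Fin V → Fin V → Bool
open Graph public

record BrushState (G : Graph) : Set where
  constructor state
  field
    brushes : Fin (V G) → ℕ
    dirty   : Fin (V G) → Fin (V G) → Bool
open BrushState public

dirtyDeg : {G : Graph} → BrushState G → Fin (V G) → ℕ
dirtyDeg {G} s v = countᵇ (dirty s v) (allFin (V G))

fire : {G : Graph} → BrushState G → Fin (V G) → BrushState G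
fire {G} s v = state b′ d′
  where
  b′ : Fin (V G) → ℕ
  b′ w with w ≟ v
  ... | yes _ = brushes s v ∸ dirtyDeg s v
  ... | no  _ = brushes s w + (if dirty s v w then 1 else 0)
  d′ : Fin (V G) → Fin (V G) → Bool
  d′ x y with x ≟ v | y ≟ v
  ... | yes _ | _     = false
  ... | no  _ | yes _ = false
  ... | no  _ | no  _ = dirty s x y

data Step {G : Graph} : BrushState G → BrushState G → Set where
  step : ∀ s v → dirtyDeg s v ≤ brushes s v → Step s (fire s v)

initial : (G : Graph) → (Fin (V G) → ℕ) → BrushState G
initial G b = state b (adj G)

AllClean : {G : Graph} → BrushState G → Set
AllClean {G} s = ∀ x y → dirty s x y ≡ false

Cleans : (G : Graph) → (Fin (V G) → ℕ) → Set
Cleans G b = ∃ λ s → Star Step (initial G b) s × AllClean s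

totalBrushes : (G : Graph) → (Fin (V G) → ℕ) → ℕ
totalBrushes G b = sum (map b (allFin (V G)))

IsBrushNumber : Graph → ℕ → Set
IsBrushNumber G k =
  (∃ λ b → Cleans G b × totalBrushes G b ≡ k) ×
  (∀ b → Cleans G b → k ≤ totalBrushes G b)

-- underlying undirected graph of J_n(1); Fin index x stands for v_{x+1}
Jaco : ℕ → Graph
Jaco n = record
  { V   = n
  ; adj = λ x y → arcᵇ (suc (toℕ x)) (suc (toℕ y)) ∨ arcᵇ (suc (toℕ y)) (suc (toℕ x))
  }

sumℤ : List ℤ → ℤ
sumℤ = foldr ℤ._+_ (+ 0)

rangeFrom : ℕ → ℕ → List ℕ
rangeFrom a m = map (λ t → a + suc t) (upTo m)

brushFormula : ℕ → ℕ → ℤ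
brushFormula n i =
  sumℤ (map (λ j → + outdeg n j ℤ.- + indeg n j) (range i)) ℤ.+
  sumℤ (map (λ j → (+ 0) ℤ.⊔ ((+ n ℤ.- + j) ℤ.- + indeg n j)) (rangeFrom i (n ∸ i)))

{-# OPTIONS --safe #-}
-- Put reach k = 2k − d⁻(v_k), the largest index of an out-neighbour of v_k in J_∞(1); it is strictly
-- increasing, so J_n(1) is a proper interval graph.
--
-- Upper bound: clean the vertices in the order v_1, ..., v_n, giving v_j exactly max(0, d⁺ − d⁻) brushes.
-- The prime Jaconian vertex v_i is the last vertex with reach ≤ n (or i = n = 1), so d⁺ ≥ d⁻ up to v_i
-- and d⁺(v_j) = n − j beyond it: the total is the formula. Moreover d⁺ − d⁻ changes sign only once, say
-- after v_t with t ≥ i, so the total also equals the number of edges leaving L = {v_1, ..., v_t}.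
--
-- Lower bound: at every moment the number of brushes is at least the number of edges between fired and
-- unfired vertices. Let W = {w : t ≤ reach w}. Both W ∩ L and W ∖ L are cliques, so every non-adjacent
-- pair inside W is separated by L. Look at the moment when the fired set F contains ∣W ∖ L∣ vertices of W:
-- F and L separate equally many pairs of W, and L separates the most non-edges, so F has at least as many
-- crossing edges as L.
module Submission where

open import Defs
open import Data.Bool using (Bool; true; false; _∧_; _∨_; not; if_then_else_)
import Data.Bool.Properties as Bool
open import Data.Nat hiding (_≟_)
open import Data.Nat.Properties hiding (_≟_; suc-injective)
import Data.Nat.ListAction as List
open import Data.Nat.Tactic.RingSolver using (solve-∀)
open import Data.Fin using (Fin; zero; suc; toℕ; fromℕ<; _≟_)
open import Data.Fin.Properties using (any?; suc-injective; toℕ<n; toℕ-fromℕ<; toℕ-injective)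
open import Data.List using ([]; _∷_; _++_; map; foldr; length; upTo; applyUpTo; tabulate)
open import Data.List.Properties using (map-tabulate; map-upTo; map-∘; map-cong; length-++)
open import Data.List.Membership.Propositional using (_∈_)
open import Data.List.Membership.Propositional.Properties using (∈-map⁺; ∈-upTo⁺)
open import Data.List.Relation.Unary.Any using (here; there)
open import Data.Product using (∃; _×_; _,_)
open import Data.Sum using (inj₁; inj₂)
open import Data.Empty using (⊥-elim)
open import Function using (_∘_; id; Equivalence)
open import Relation.Nullary using (¬_; yes; no; does)
open import Relation.Nullary.Decidable using (dec-true; dec-false)
open import Relation.Binary.Definitions using (tri<; tri≈; tri>)
open import Relation.Binary.PropositionalEquality
open import Relation.Binary.Construct.Closure.ReflexiveTransitive using (Star; ε; _◅_)
open import Algebra.Properties.Semiring.Sum +-*-semiring using (sum-cong-≗; sum-replicate-zero; ∑-distrib-+; ∑-comm; *-distribˡ-sum; *-distribʳ-sum) renaming (sum to ∑)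

-- Truth values as numbers, and sums over finite types

⟦_⟧ : Bool → ℕ
⟦ b ⟧ = if b then 1 else 0

<⇒<ᵇ≡true : ∀ {m n} → m < n → (m <ᵇ n) ≡ true
<⇒<ᵇ≡true {m} {n} = dec-true (m <? n)

≮⇒<ᵇ≡false : ∀ {m n} → n ≤ m → (m <ᵇ n) ≡ false
≮⇒<ᵇ≡false {m} {n} n≤m = dec-false (m <? n) (≤⇒≯ n≤m)

≤⇒≤ᵇ≡true : ∀ {m n} → m ≤ n → (m ≤ᵇ n) ≡ true
≤⇒≤ᵇ≡true {m} {n} = dec-true (m ≤? n)

<⇒≤ᵇ≡false : ∀ {m n} → n < m → (m ≤ᵇ n) ≡ false
<⇒≤ᵇ≡false {m} {n} n<m = dec-false (m ≤? n) (<⇒≱ n<m)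

<ᵇ≡true⇒< : ∀ m n → (m <ᵇ n) ≡ true → m < n
<ᵇ≡true⇒< m n eq = <ᵇ⇒< m n (Equivalence.from Bool.T-≡ eq)

<ᵇ≡false⇒≥ : ∀ m n → (m <ᵇ n) ≡ false → n ≤ m
<ᵇ≡false⇒≥ m n eq with n ≤? m
... | yes le = le
... | no ≰ with () ← trans (sym eq) (<⇒<ᵇ≡true (≰⇒> ≰))

∑-mono : ∀ {n} {f g : Fin n → ℕ} → (∀ i → f i ≤ g i) → ∑ f ≤ ∑ g
∑-mono {zero}  _   = z≤n
∑-mono {suc n} f≤g = +-mono-≤ (f≤g zero) (∑-mono (f≤g ∘ suc))

∑-update : ∀ {n} {f g : Fin n → ℕ} {c} i → (∀ j → j ≢ i → f j ≡ g j) → f i ≡ g i + c → ∑ f ≡ ∑ g + c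
∑-update {suc n} {f} {g} {c} zero same at = begin
  f zero + ∑ (f ∘ suc)     ≡⟨ cong₂ _+_ at (sum-cong-≗ λ j → same (suc j) λ ()) ⟩
  g zero + c + ∑ (g ∘ suc) ≡⟨ shuffle (g zero) c (∑ (g ∘ suc)) ⟩
  g zero + ∑ (g ∘ suc) + c ∎
  where
  open ≡-Reasoning
  shuffle : ∀ a b c → a + b + c ≡ a + c + b
  shuffle = solve-∀
∑-update {suc n} {f} {g} {c} (suc i) same at = begin
  f zero + ∑ (f ∘ suc)       ≡⟨ cong₂ _+_ (same zero λ ()) (∑-update i (λ j j≢i → same (suc j) (j≢i ∘ suc-injective)) at) ⟩
  g zero + (∑ (g ∘ suc) + c) ≡⟨ +-assoc (g zero) _ c ⟨
  g zero + ∑ (g ∘ suc) + c   ∎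
  where open ≡-Reasoning

∑∑-* : ∀ {n} (f g : Fin n → ℕ) → ∑ (λ i → ∑ (λ j → f i * g j)) ≡ ∑ f * ∑ g
∑∑-* f g = begin
  ∑ (λ i → ∑ (λ j → f i * g j)) ≡⟨ sum-cong-≗ (λ i → *-distribˡ-sum (f i) g) ⟨
  ∑ (λ i → f i * ∑ g)           ≡⟨ *-distribʳ-sum (∑ g) f ⟨
  ∑ f * ∑ g                     ∎
  where open ≡-Reasoning

∑∑-distrib-+ : ∀ {n} (f g : Fin n → Fin n → ℕ) →
  ∑ (λ i → ∑ (λ j → f i j + g i j)) ≡ ∑ (λ i → ∑ (f i)) + ∑ (λ i → ∑ (g i))
∑∑-distrib-+ f g = trans (sum-cong-≗ λ i → ∑-distrib-+ (f i) (g i)) (∑-distrib-+ (∑ ∘ f) (∑ ∘ g))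

sum-tabulate : ∀ {n} (f : Fin n → ℕ) → List.sum (tabulate f) ≡ ∑ f
sum-tabulate {zero}  f = refl
sum-tabulate {suc n} f = cong (f zero +_) (sum-tabulate (f ∘ suc))

totalBrushes-∑ : ∀ G b → totalBrushes G b ≡ ∑ b
totalBrushes-∑ G b = trans (cong List.sum (map-tabulate id b)) (sum-tabulate b)

countᵇ-tabulate : ∀ {n} {A : Set} (p : A → Bool) (f : Fin n → A) → countᵇ p (tabulate f) ≡ ∑ (λ i → ⟦ p (f i) ⟧)
countᵇ-tabulate {zero}  p f = refl
countᵇ-tabulate {suc n} p f = cong (⟦ p (f zero) ⟧ +_) (countᵇ-tabulate p (f ∘ suc))

dirtyDeg-∑ : ∀ {G} (s : BrushState G) v → dirtyDeg s v ≡ ∑ (λ w → ⟦ dirty s v w ⟧)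
dirtyDeg-∑ s v = countᵇ-tabulate (dirty s v) id

-- The cleaning process

module Cleaning (G : Graph) (irrefl : ∀ v → adj G v v ≡ false) where

  VertexSet : Set
  VertexSet = Fin (V G) → Bool

  insert : Fin (V G) → VertexSet → VertexSet
  insert v F x = does (x ≟ v) ∨ F x

  insert-∋ : ∀ v F → insert v F v ≡ true
  insert-∋ v F rewrite dec-true (v ≟ v) refl = refl

  insert-other : ∀ {v} F {x} → x ≢ v → insert v F x ≡ F x
  insert-other {v} F {x} x≢v rewrite dec-false (x ≟ v) x≢v = refl

  -- The process allows a vertex to fire again, so `v` may already lie in `F`; the factor
  -- `not (F v)` prevents a second count.
  ∑-insert : ∀ v F (p : Fin (V G) → Bool) →
    ∑ (λ x → ⟦ insert v F x ∧ p x ⟧) ≡ ∑ (λ x → ⟦ F x ∧ p x ⟧) + ⟦ not (F v) ∧ p v ⟧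
  ∑-insert v F p = ∑-update v (λ x x≢v → cong (λ b → ⟦ b ∧ p x ⟧) (insert-other F x≢v)) at
    where
    at : ⟦ insert v F v ∧ p v ⟧ ≡ ⟦ F v ∧ p v ⟧ + ⟦ not (F v) ∧ p v ⟧
    at rewrite insert-∋ v F with F v | p v
    ... | true  | true  = refl
    ... | true  | false = refl
    ... | false | true  = refl
    ... | false | false = refl

  cut : VertexSet → ℕ
  cut F = ∑ (λ v → ∑ (λ w → ⟦ F v ∧ not (F w) ∧ adj G v w ⟧))

  -- F is the set of vertices that have fired on the way from the allocation b to s.
  record Reached (b : Fin (V G) → ℕ) (F : VertexSet) (s : BrushState G) : Set where
    field
      dirty-edges : ∀ x y → dirty s x y ≡ adj G x y ∧ not (F x) ∧ not (F y)
      received    : ∀ w → F w ≡ false → brushes s w ≡ b w + ∑ (λ v → ⟦ F v ∧ adj G v w ⟧)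
      conserved   : ∑ (brushes s) ≡ ∑ b
  open Reached

  -- Asking only for a pointwise empty `F` covers both starting points in use: the constant `false`
  -- and `toℕ x <ᵇ 0`.
  Reached-initial : ∀ b {F} → (∀ v → F v ≡ false) → Reached b F (initial G b)
  Reached-initial b {F} empty .dirty-edges x y rewrite empty x | empty y = sym (Bool.∧-identityʳ _)
  Reached-initial b {F} empty .received w _ = sym (trans (cong (b w +_) zeros) (+-identityʳ _))
    where
    zeros : ∑ (λ v → ⟦ F v ∧ adj G v w ⟧) ≡ 0
    zeros = trans (sum-cong-≗ λ v → cong (λ c → ⟦ c ∧ adj G v w ⟧) (empty v))
                  (sum-replicate-zero (V G))
  Reached-initial b empty .conserved = refl

  brushes-fire-self : ∀ s v → brushes (fire {G} s v) v ≡ brushes s v ∸ dirtyDeg s v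
  brushes-fire-self s v with v ≟ v
  ... | yes _  = refl
  ... | no v≢v = ⊥-elim (v≢v refl)

  brushes-fire-other : ∀ s {v w} → w ≢ v → brushes (fire {G} s v) w ≡ brushes s w + ⟦ dirty s v w ⟧
  brushes-fire-other s {v} {w} w≢v with w ≟ v
  ... | yes w≡v = ⊥-elim (w≢v w≡v)
  ... | no _    = refl

  -- One brush moves along each dirty edge at `v`, which is what the new member `v` of `F` adds at
  -- its unfired neighbours. The hypothesis `dirtyDeg s v ≤ brushes s v` makes the truncated
  -- subtraction at `v` exact, so no brush is created. If `v` has fired before, it has no dirty edge
  -- left and nothing moves.
  Reached-fire : ∀ {b F s} v → dirtyDeg s v ≤ brushes s v → Reached b F s → Reached b (insert v F) (fire s v)
  Reached-fire {b} {F} {s} v enough r .dirty-edges x y with x ≟ v | y ≟ v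
  ... | yes _ | _     = sym (Bool.∧-zeroʳ _)
  ... | no _  | yes _ = sym (trans (cong (adj G x y ∧_) (Bool.∧-zeroʳ _)) (Bool.∧-zeroʳ _))
  ... | no _  | no _  = r .dirty-edges x y
  Reached-fire {b} {F} {s} v enough r .received w unfired with w ≟ v
  ... | no _ = begin
    brushes s w + ⟦ dirty s v w ⟧
      ≡⟨ cong₂ (λ m c → m + ⟦ c ⟧) (r .received w unfired) (r .dirty-edges v w) ⟩
    b w + ∑ (λ u → ⟦ F u ∧ adj G u w ⟧) + ⟦ adj G v w ∧ not (F v) ∧ not (F w) ⟧
      ≡⟨ +-assoc (b w) _ _ ⟩
    b w + (∑ (λ u → ⟦ F u ∧ adj G u w ⟧) + ⟦ adj G v w ∧ not (F v) ∧ not (F w) ⟧)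
      ≡⟨ cong (λ c → b w + (∑ (λ u → ⟦ F u ∧ adj G u w ⟧) + ⟦ c ⟧)) rearrange ⟩
    b w + (∑ (λ u → ⟦ F u ∧ adj G u w ⟧) + ⟦ not (F v) ∧ adj G v w ⟧)
      ≡⟨ cong (b w +_) (∑-insert v F (λ u → adj G u w)) ⟨
    b w + ∑ (λ u → ⟦ insert v F u ∧ adj G u w ⟧) ∎
    where
    open ≡-Reasoning
    rearrange : adj G v w ∧ not (F v) ∧ not (F w) ≡ not (F v) ∧ adj G v w
    rearrange rewrite unfired = trans (cong (adj G v w ∧_) (Bool.∧-identityʳ _)) (Bool.∧-comm (adj G v w) _)
  Reached-fire {b} {F} {s} v enough r .conserved = trans (+-cancelʳ-≡ (dirtyDeg s v) _ _ balance) (r .conserved)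
    where
    open ≡-Reasoning
    -- In the absence of a loop, `brushes s w + ⟦ dirty s v w ⟧` can be summed over all `w`: it
    -- differs from the new state only at `v`, where it is too large by `dirtyDeg s v`.
    clean-loop : dirty s v v ≡ false
    clean-loop rewrite r .dirty-edges v v | irrefl v = refl
    self : brushes s v + ⟦ dirty s v v ⟧ ≡ brushes (fire s v) v + dirtyDeg s v
    self = begin
      brushes s v + ⟦ dirty s v v ⟧               ≡⟨ cong (λ c → brushes s v + ⟦ c ⟧) clean-loop ⟩
      brushes s v + 0                             ≡⟨ +-identityʳ _ ⟩
      brushes s v                                 ≡⟨ m∸n+n≡m enough ⟨
      brushes s v ∸ dirtyDeg s v + dirtyDeg s v   ≡⟨ cong (_+ dirtyDeg s v) (brushes-fire-self s v) ⟨
      brushes (fire s v) v + dirtyDeg s v         ∎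
    balance : ∑ (brushes (fire s v)) + dirtyDeg s v ≡ ∑ (brushes s) + dirtyDeg s v
    balance = begin
      ∑ (brushes (fire s v)) + dirtyDeg s v        ≡⟨ ∑-update v (λ w w≢v → sym (brushes-fire-other s w≢v)) self ⟨
      ∑ (λ w → brushes s w + ⟦ dirty s v w ⟧)      ≡⟨ ∑-distrib-+ (brushes s) _ ⟩
      ∑ (brushes s) + ∑ (λ w → ⟦ dirty s v w ⟧)    ≡⟨ cong (∑ (brushes s) +_) (dirtyDeg-∑ s v) ⟨
      ∑ (brushes s) + dirtyDeg s v                 ∎

  -- An unfired vertex still holds every brush sent to it, one from each fired neighbour, and the
  -- total number of brushes never changes.
  cut≤total : ∀ {b F s} → Reached b F s → cut F ≤ ∑ b
  cut≤total {b} {F} {s} r = begin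
    cut F                                                    ≡⟨ ∑-comm (λ v w → ⟦ F v ∧ not (F w) ∧ adj G v w ⟧) ⟩
    ∑ (λ w → ∑ (λ v → ⟦ F v ∧ not (F w) ∧ adj G v w ⟧))      ≤⟨ ∑-mono held ⟩
    ∑ (brushes s)                                            ≡⟨ r .conserved ⟩
    ∑ b                                                      ∎
    where
    open ≤-Reasoning
    weaken : ∀ x y z → ⟦ x ∧ y ∧ z ⟧ ≤ ⟦ x ∧ z ⟧
    weaken false y     z = z≤n
    weaken true  false z = z≤n
    weaken true  true  z = ≤-refl
    vanish : ∀ x z → ⟦ x ∧ false ∧ z ⟧ ≤ 0
    vanish false z = z≤n
    vanish true  z = z≤n
    held : ∀ w → ∑ (λ v → ⟦ F v ∧ not (F w) ∧ adj G v w ⟧) ≤ brushes s w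
    held w with F w in eq
    ... | true = begin
      ∑ (λ v → ⟦ F v ∧ false ∧ adj G v w ⟧) ≤⟨ ∑-mono (λ v → vanish (F v) (adj G v w)) ⟩
      ∑ {V G} (λ _ → 0)                     ≡⟨ sum-replicate-zero (V G) ⟩
      0                                     ≤⟨ z≤n ⟩
      brushes s w                           ∎
    ... | false = begin
      ∑ (λ v → ⟦ F v ∧ true ∧ adj G v w ⟧)        ≤⟨ ∑-mono (λ v → weaken (F v) true (adj G v w)) ⟩
      ∑ (λ v → ⟦ F v ∧ adj G v w ⟧)               ≤⟨ m≤n+m _ (b w) ⟩
      b w + ∑ (λ v → ⟦ F v ∧ adj G v w ⟧)         ≡⟨ r .received w eq ⟨
      brushes s w                                 ∎

  -- Lower bounds from one moment of the process

  card : VertexSet → VertexSet → ℕ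
  card W F = ∑ (λ x → ⟦ F x ∧ W x ⟧)

  unfired-member : ∀ W F → card W F < ∑ (λ x → ⟦ W x ⟧) → ∃ λ v → F v ≡ false × W v ≡ true
  unfired-member W F lt with any? (λ v → not (F v) ∧ W v Bool.≟ true)
  ... | yes (v , eq) = v , split (F v) (W v) eq
    where
    split : ∀ x y → not x ∧ y ≡ true → x ≡ false × y ≡ true
    split false true  _ = refl , refl
    split false false ()
    split true  _     ()
  ... | no none = ⊥-elim (<⇒≱ lt (∑-mono λ v → bound (F v) (W v) (λ eq → none (v , eq))))
    where
    bound : ∀ x y → ¬ (not x ∧ y ≡ true) → ⟦ y ⟧ ≤ ⟦ x ∧ y ⟧
    bound true  y     _ = ≤-refl
    bound false false _ = z≤n
    bound false true  h = ⊥-elim (h refl)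

  AllClean-fire : ∀ {s} v → AllClean {G} s → AllClean (fire s v)
  AllClean-fire v clean x y with x ≟ v | y ≟ v
  ... | yes _ | _     = refl
  ... | no _  | yes _ = refl
  ... | no _  | no _  = clean x y

  module _ {b : Fin (V G) → ℕ} (W : VertexSet) (m : ℕ) (m≤∣W∣ : m ≤ ∑ (λ x → ⟦ W x ⟧))
           (B : ℕ) (B≤cut : ∀ F → card W F ≡ m → B ≤ cut F) where

    -- All edges may be clean before m vertices of W have fired; the others then fire for free.
    finish : ∀ {F s} k → AllClean s → Reached b F s → k + card W F ≡ m → B ≤ ∑ b
    finish {F} zero    clean r eq = ≤-trans (B≤cut F eq) (cut≤total r)
    finish {F} {s} (suc k) clean r eq
      with v , unfired , v∈W ← unfired-member W F (≤-trans (≤-trans (s≤s (m≤n+m _ k)) (≤-reflexive eq)) m≤∣W∣) =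
      finish k (AllClean-fire v clean) (Reached-fire v enough r) (trans (cong (k +_) grown) (trans (+-suc k _) eq))
      where
      enough : dirtyDeg s v ≤ brushes s v
      enough = begin
        dirtyDeg s v                   ≡⟨ dirtyDeg-∑ s v ⟩
        ∑ (λ w → ⟦ dirty s v w ⟧)      ≡⟨ sum-cong-≗ (λ w → cong ⟦_⟧ (clean v w)) ⟩
        ∑ {V G} (λ _ → 0)              ≡⟨ sum-replicate-zero (V G) ⟩
        0                              ≤⟨ z≤n ⟩
        brushes s v                    ∎
        where open ≤-Reasoning
      grown : card W (insert v F) ≡ suc (card W F)
      grown = trans (∑-insert v F W) (trans (cong (card W F +_) one) (+-comm (card W F) 1))
        where
        one : ⟦ not (F v) ∧ W v ⟧ ≡ 1
        one rewrite unfired | v∈W = refl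

    -- A step raises the number of fired vertices of `W` by at most one, so the process cannot jump
    -- over `m`. Either the count equals `m` at some state, and the cut at that state bounds the
    -- total, or the process ends early and `finish` prolongs it.
    run : ∀ {F s s′} → Star Step s s′ → AllClean s′ → Reached b F s → card W F ≤ m → B ≤ ∑ b
    run {F} ε clean r le = finish (m ∸ card W F) clean r (m∸n+n≡m le)
    run {F} (step s v enough ◅ steps) clean r le with m≤n⇒m<n∨m≡n le
    ... | inj₂ eq = ≤-trans (B≤cut F eq) (cut≤total r)
    ... | inj₁ lt = run steps clean (Reached-fire v enough r) (begin
      card W (insert v F)               ≡⟨ ∑-insert v F W ⟩
      card W F + ⟦ not (F v) ∧ W v ⟧    ≤⟨ +-monoʳ-≤ (card W F) (⟦⟧≤1 (not (F v) ∧ W v)) ⟩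
      card W F + 1                      ≡⟨ +-comm (card W F) 1 ⟩
      suc (card W F)                    ≤⟨ lt ⟩
      m                                 ∎)
      where
      open ≤-Reasoning
      ⟦⟧≤1 : ∀ c → ⟦ c ⟧ ≤ 1
      ⟦⟧≤1 true  = ≤-refl
      ⟦⟧≤1 false = z≤n

    Cleans⇒≥ : Cleans G b → B ≤ ∑ b
    Cleans⇒≥ (_ , steps , clean) = run steps clean (Reached-initial b (λ _ → refl))
      (≤-trans (≤-reflexive (sum-replicate-zero (V G))) z≤n)

  -- Cleaning the vertices in the order of their indices

  module _ (b : Fin (V G) → ℕ)
           (supply : ∀ v → ∑ (λ w → ⟦ adj G v w ∧ not (toℕ w <ᵇ toℕ v) ⟧)
                         ≤ b v + ∑ (λ u → ⟦ (toℕ u <ᵇ toℕ v) ∧ adj G u v ⟧)) where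

    -- At its turn, `v` holds `b v` and one brush from each earlier neighbour, and its dirty edges
    -- lead to the vertices that are not earlier; `supply` compares exactly these two numbers. The
    -- recursion is on `d`, the number of vertices still to fire.
    sweep : ∀ {F s} d k → d + k ≡ V G → (∀ x → F x ≡ (toℕ x <ᵇ k)) → Reached b F s →
      ∃ λ s′ → Star Step s s′ × AllClean s′
    sweep {F} {s} zero k refl F≡ r = s , ε , λ x y → trans (r .dirty-edges x y)
      (trans (cong (λ c → adj G x y ∧ not c ∧ not (F y)) (trans (F≡ x) (<⇒<ᵇ≡true (toℕ<n x)))) (Bool.∧-zeroʳ _))
    sweep {F} {s} (suc d) k eq F≡ r =
      let s′ , steps , clean = sweep d (suc k) (trans (+-suc d k) eq) F′≡ (Reached-fire v enough r)
      in s′ , step s v enough ◅ steps , clean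
      where
      k<V : k < V G
      k<V = subst (suc k ≤_) eq (s≤s (m≤n+m k d))
      v : Fin (V G)
      v = fromℕ< k<V
      v≡k : toℕ v ≡ k
      v≡k = toℕ-fromℕ< k<V
      F≡′ : ∀ x → F x ≡ (toℕ x <ᵇ toℕ v)
      F≡′ x = trans (F≡ x) (cong (toℕ x <ᵇ_) (sym v≡k))
      unfired : F v ≡ false
      unfired = trans (F≡′ v) (≮⇒<ᵇ≡false (≤-refl {toℕ v}))
      F′≡ : ∀ x → insert v F x ≡ (toℕ x <ᵇ suc k)
      F′≡ x with x ≟ v
      ... | yes refl = sym (<⇒<ᵇ≡true (s≤s (≤-reflexive v≡k)))
      ... | no x≢v with toℕ x <? k
      ...   | yes x<k = trans (F≡ x) (trans (<⇒<ᵇ≡true x<k) (sym (<⇒<ᵇ≡true (m≤n⇒m≤1+n x<k))))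
      ...   | no x≮k  = trans (F≡ x) (trans (≮⇒<ᵇ≡false (≮⇒≥ x≮k))
                          (sym (≮⇒<ᵇ≡false (≤∧≢⇒< (≮⇒≥ x≮k) λ k≡x → x≢v (toℕ-injective (trans (sym k≡x) (sym v≡k)))))))
      enough : dirtyDeg s v ≤ brushes s v
      enough = begin
        dirtyDeg s v                                              ≡⟨ dirtyDeg-∑ s v ⟩
        ∑ (λ w → ⟦ dirty s v w ⟧)                                 ≡⟨ sum-cong-≗ (λ w → cong ⟦_⟧ (still-dirty w)) ⟩
        ∑ (λ w → ⟦ adj G v w ∧ not (toℕ w <ᵇ toℕ v) ⟧)            ≤⟨ supply v ⟩
        b v + ∑ (λ u → ⟦ (toℕ u <ᵇ toℕ v) ∧ adj G u v ⟧)          ≡⟨ cong (b v +_) (sum-cong-≗ λ u → cong (λ c → ⟦ c ∧ adj G u v ⟧) (F≡′ u)) ⟨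
        b v + ∑ (λ u → ⟦ F u ∧ adj G u v ⟧)                       ≡⟨ r .received v unfired ⟨
        brushes s v                                               ∎
        where
        open ≤-Reasoning
        still-dirty : ∀ w → dirty s v w ≡ adj G v w ∧ not (toℕ w <ᵇ toℕ v)
        still-dirty w = trans (r .dirty-edges v w) (cong₂ (λ c e → adj G v w ∧ not c ∧ not e) unfired (F≡′ w))

    supply⇒Cleans : Cleans G b
    supply⇒Cleans = sweep {F = λ x → toℕ x <ᵇ 0} (V G) 0 (+-identityʳ _) (λ _ → refl) (Reached-initial b λ _ → refl)

  -- By cliques, the non-adjacent pairs inside W all cross the cut L.
  module _ (symmetric : ∀ v w → adj G v w ≡ adj G w v) (W L : VertexSet)
           (cliques : ∀ {v w} → v ≢ w → W v ≡ true → W w ≡ true → L v ≡ L w → adj G v w ≡ true)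
           (beyond-L : ∀ {w} → L w ≡ false → W w ≡ true)
           (boundary : ∀ {v w} → L v ≡ true → L w ≡ false → adj G v w ≡ true → W v ≡ true) where

    -- The complement of `L` lies in `W`, so the hypothesis says that `F` and `L` split `W` into
    -- parts of the same two sizes, in opposite order. Hence both separate equally many pairs of
    -- `W`. For `L` these pairs are its crossing edges together with the pairs in `N`; for `F` each
    -- is a crossing edge or a non-edge, and every non-edge of `W` appears in `N`.
    cut-minimal : ∀ F → card W F ≡ ∑ (λ x → ⟦ not (L x) ⟧) → cut L ≤ cut F
    cut-minimal F eq = +-cancelʳ-≤ (∑∑ N) _ _ (begin
      cut L + ∑∑ N                            ≡⟨ ∑∑-distrib-+ (crossing L) N ⟨
      ∑∑ (λ v w → crossing L v w + N v w)     ≡⟨ ∑∑-cong split-L ⟩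
      ∑∑ (λ v w → l v * h w)                  ≡⟨ ∑∑-* l h ⟩
      ∑ l * ∑ h                               ≡⟨ *-comm (∑ l) (∑ h) ⟩
      ∑ h * ∑ l                               ≡⟨ cong₂ _*_ eq c≡l ⟨
      ∑ a * ∑ c                               ≡⟨ ∑∑-* a c ⟨
      ∑∑ (λ v w → a v * c w)                  ≤⟨ ∑∑-mono split-F ⟩
      ∑∑ (λ v w → crossing F v w + (out v w * N v w + out v w * N w v))
        ≡⟨ ∑∑-distrib-+ (crossing F) (λ v w → out v w * N v w + out v w * N w v) ⟩
      cut F + ∑∑ (λ v w → out v w * N v w + out v w * N w v)
        ≡⟨ cong (cut F +_) (∑∑-distrib-+ (λ v w → out v w * N v w) (λ v w → out v w * N w v)) ⟩
      cut F + (∑∑ (λ v w → out v w * N v w) + ∑∑ (λ v w → out v w * N w v))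
        -- A non-edge leaving `F` may cross `L` in either direction. Renaming the variables charges
        -- both directions to the same `N v w`, and `out v w` and `out w v` are never both 1.
        ≡⟨ cong (λ z → cut F + (∑∑ (λ v w → out v w * N v w) + z)) (∑-comm (λ v w → out v w * N w v)) ⟩
      cut F + (∑∑ (λ v w → out v w * N v w) + ∑∑ (λ v w → out w v * N v w))
        ≡⟨ cong (cut F +_) (∑∑-distrib-+ (λ v w → out v w * N v w) (λ v w → out w v * N v w)) ⟨
      cut F + ∑∑ (λ v w → out v w * N v w + out w v * N v w)
        ≤⟨ +-monoʳ-≤ (cut F) (∑∑-mono λ v w → one-way (F v) (F w) (N v w)) ⟩
      cut F + ∑∑ N                            ∎)
      where
      open ≤-Reasoning
      ∑∑ : (Fin (V G) → Fin (V G) → ℕ) → ℕ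
      ∑∑ f = ∑ (λ v → ∑ (f v))
      ∑∑-cong : ∀ {f g} → (∀ v w → f v w ≡ g v w) → ∑∑ f ≡ ∑∑ g
      ∑∑-cong f≡g = sum-cong-≗ λ v → sum-cong-≗ (f≡g v)
      ∑∑-mono : ∀ {f g} → (∀ v w → f v w ≤ g v w) → ∑∑ f ≤ ∑∑ g
      ∑∑-mono f≤g = ∑-mono λ v → ∑-mono (f≤g v)

      crossing : VertexSet → Fin (V G) → Fin (V G) → ℕ
      crossing S v w = ⟦ S v ∧ not (S w) ∧ adj G v w ⟧
      -- `N` marks the non-edges of `W` across `L`, each once, from its end in `L`; the other end
      -- lies in `W` by `beyond-L`.
      N out : Fin (V G) → Fin (V G) → ℕ
      N v w   = ⟦ W v ∧ L v ∧ not (L w) ∧ not (adj G v w) ⟧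
      out v w = ⟦ F v ∧ not (F w) ⟧
      a c l h : Fin (V G) → ℕ
      a v = ⟦ F v ∧ W v ⟧
      c v = ⟦ not (F v) ∧ W v ⟧
      l v = ⟦ L v ∧ W v ⟧
      h v = ⟦ not (L v) ⟧

      -- Both sides equal the indicator of `W`, the right one because `beyond-L` puts the complement
      -- of `L` inside `W`.
      a+c≡l+h : ∀ v → a v + c v ≡ l v + h v
      a+c≡l+h v with L v in Lv | W v in Wv
      ... | false | false with () ← trans (sym Wv) (beyond-L Lv)
      ... | false | true  with F v
      ...   | true  = refl
      ...   | false = refl
      a+c≡l+h v | true | Wv with F v | Wv
      ...   | true  | true  = refl
      ...   | false | true  = refl
      ...   | true  | false = refl
      ...   | false | false = refl

      c≡l : ∑ c ≡ ∑ l
      c≡l = +-cancelˡ-≡ (∑ h) _ _ (begin-equality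
        ∑ h + ∑ c               ≡⟨ cong (_+ ∑ c) eq ⟨
        ∑ a + ∑ c               ≡⟨ ∑-distrib-+ a c ⟨
        ∑ (λ v → a v + c v)     ≡⟨ sum-cong-≗ a+c≡l+h ⟩
        ∑ (λ v → l v + h v)     ≡⟨ ∑-distrib-+ l h ⟩
        ∑ l + ∑ h               ≡⟨ +-comm (∑ l) (∑ h) ⟩
        ∑ h + ∑ l               ∎)

      split-L : ∀ v w → crossing L v w + N v w ≡ l v * h w
      split-L v w with L v in Lv | L w in Lw | W v in Wv | adj G v w in vw
      ... | false | _     | true  | _     = refl
      ... | false | _     | false | _     = refl
      ... | true  | true  | true  | _     = refl
      ... | true  | true  | false | _     = refl
      ... | true  | false | true  | true  = refl
      ... | true  | false | true  | false = refl
      ... | true  | false | false | false = refl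
      ... | true  | false | false | true  with () ← trans (sym Wv) (boundary Lv Lw vw)

      adjacent : ∀ {v w} → F v ≡ true → F w ≡ false → W v ≡ true → W w ≡ true → L v ≡ L w → adj G v w ≢ false
      adjacent Fv Fw Wv Ww Lvw vw =
        true≢false (trans (sym (cliques (λ { refl → true≢false (trans (sym Fv) Fw) }) Wv Ww Lvw)) vw)
        where
        true≢false : true ≢ false
        true≢false ()

      split-F : ∀ v w → a v * c w ≤ crossing F v w + (out v w * N v w + out v w * N w v)
      split-F v w with F v in Fv | F w in Fw | W v in Wv | W w in Ww
      ... | false | _     | _     | _     = z≤n
      ... | true  | _     | false | _     = z≤n
      ... | true  | true  | true  | _     = z≤n
      ... | true  | false | true  | false = z≤n
      ... | true  | false | true  | true  with adj G v w in vw
      ...   | true  = s≤s z≤n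
      ...   | false rewrite trans (symmetric w v) vw with L v in Lv | L w in Lw
      ...     | true  | false = s≤s z≤n
      ...     | false | true  = s≤s z≤n
      ...     | true  | true  = ⊥-elim (adjacent Fv Fw Wv Ww (trans Lv (sym Lw)) vw)
      ...     | false | false = ⊥-elim (adjacent Fv Fw Wv Ww (trans Lv (sym Lw)) vw)

      one-way : ∀ x y N → ⟦ x ∧ not y ⟧ * N + ⟦ y ∧ not x ⟧ * N ≤ N
      one-way true  true  N = z≤n
      one-way true  false N = ≤-reflexive (trans (+-identityʳ _) (+-identityʳ N))
      one-way false true  N = ≤-reflexive (+-identityʳ N)
      one-way false false N = z≤n

-- The structure of the Jaco graphs

⟦≤ᵇ⟧-mono : ∀ {a b c d} → (a ≤ b → c ≤ d) → ⟦ a ≤ᵇ b ⟧ ≤ ⟦ c ≤ᵇ d ⟧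
⟦≤ᵇ⟧-mono {a} {b} imp with a ≤? b
... | yes a≤b rewrite ≤⇒≤ᵇ≡true a≤b | ≤⇒≤ᵇ≡true (imp a≤b) = ≤-refl
... | no a≰b  rewrite <⇒≤ᵇ≡false (≰⇒> a≰b) = z≤n

-- Sums over the indices 1 to n

Σ₁ : (ℕ → ℕ) → ℕ → ℕ
Σ₁ f zero    = 0
Σ₁ f (suc n) = Σ₁ f n + f (suc n)

Σ₁-cong : ∀ {f g} n → (∀ j → 1 ≤ j → j ≤ n → f j ≡ g j) → Σ₁ f n ≡ Σ₁ g n
Σ₁-cong zero    eq = refl
Σ₁-cong (suc n) eq = cong₂ _+_ (Σ₁-cong n λ j 1≤j j≤n → eq j 1≤j (m≤n⇒m≤1+n j≤n)) (eq (suc n) (s≤s z≤n) ≤-refl)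

Σ₁-mono : ∀ {f g} n → (∀ j → f j ≤ g j) → Σ₁ f n ≤ Σ₁ g n
Σ₁-mono zero    le = z≤n
Σ₁-mono (suc n) le = +-mono-≤ (Σ₁-mono n le) (le (suc n))

Σ₁-shift : ∀ f n → Σ₁ f (suc n) ≡ f 1 + Σ₁ (f ∘ suc) n
Σ₁-shift f zero    = +-comm 0 (f 1)
Σ₁-shift f (suc n) = trans (cong (_+ f (2 + n)) (Σ₁-shift f n)) (+-assoc (f 1) _ _)

Σ₁-+ : ∀ f g n → Σ₁ (λ j → f j + g j) n ≡ Σ₁ f n + Σ₁ g n
Σ₁-+ f g zero    = refl
Σ₁-+ f g (suc n) = trans (cong (_+ (f (suc n) + g (suc n))) (Σ₁-+ f g n)) (interchange (Σ₁ f n) (Σ₁ g n) _ _)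
  where
  interchange : ∀ a b c d → a + b + (c + d) ≡ a + c + (b + d)
  interchange = solve-∀

Σ₁-one : ∀ n → Σ₁ (λ _ → 1) n ≡ n
Σ₁-one zero    = refl
Σ₁-one (suc n) = trans (cong (_+ 1) (Σ₁-one n)) (+-comm n 1)

Σ₁-truncate : ∀ {f m n} → m ≤ n → (∀ j → m < j → f j ≡ 0) → Σ₁ f n ≡ Σ₁ f m
Σ₁-truncate {f} {m} m≤n vanish = go (≤⇒≤′ m≤n)
  where
  go : ∀ {n} → m ≤′ n → Σ₁ f n ≡ Σ₁ f m
  go ≤′-refl        = refl
  go (≤′-step m≤′n) = trans (cong₂ _+_ (go m≤′n) (vanish _ (s≤s (≤′⇒≤ m≤′n)))) (+-identityʳ _)

rangeFrom-suc : ∀ a m → rangeFrom a (suc m) ≡ suc a ∷ rangeFrom (suc a) m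
rangeFrom-suc a m = cong₂ _∷_ (+-comm a 1) (begin
  map (λ t → a + suc t) (applyUpTo suc m)  ≡⟨ cong (map _) (map-upTo suc m) ⟨
  map (λ t → a + suc t) (map suc (upTo m)) ≡⟨ map-∘ (upTo m) ⟨
  map (λ t → a + suc (suc t)) (upTo m)     ≡⟨ map-cong (λ t → +-suc a (suc t)) (upTo m) ⟩
  rangeFrom (suc a) m                      ∎)
  where
  open ≡-Reasoning

countᵇ-rangeFrom : ∀ p a m → Σ₁ (⟦_⟧ ∘ p) a + countᵇ p (rangeFrom a m) ≡ Σ₁ (⟦_⟧ ∘ p) (a + m)
countᵇ-rangeFrom p a zero    = trans (+-identityʳ _) (cong (Σ₁ _) (sym (+-identityʳ a)))
countᵇ-rangeFrom p a (suc m) = begin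
  Σ₁ (⟦_⟧ ∘ p) a + countᵇ p (rangeFrom a (suc m))                     ≡⟨ cong (λ xs → Σ₁ (⟦_⟧ ∘ p) a + countᵇ p xs) (rangeFrom-suc a m) ⟩
  Σ₁ (⟦_⟧ ∘ p) a + (⟦ p (suc a) ⟧ + countᵇ p (rangeFrom (suc a) m))   ≡⟨ +-assoc (Σ₁ (⟦_⟧ ∘ p) a) _ _ ⟨
  Σ₁ (⟦_⟧ ∘ p) (suc a) + countᵇ p (rangeFrom (suc a) m)               ≡⟨ countᵇ-rangeFrom p (suc a) m ⟩
  Σ₁ (⟦_⟧ ∘ p) (suc a + m)                                            ≡⟨ cong (Σ₁ _) (+-suc a m) ⟨
  Σ₁ (⟦_⟧ ∘ p) (a + suc m)                                            ∎
  where open ≡-Reasoning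

countᵇ-range : ∀ p n → countᵇ p (range n) ≡ Σ₁ (⟦_⟧ ∘ p) n
countᵇ-range p n = countᵇ-rangeFrom p 0 n

-- Reach and in-degree in the infinite graph

reach : ℕ → ℕ
reach k = 2 * k ∸ indeg∞ k

arcsInto-++ : ∀ ℓ j ds d → arcsInto ℓ j (ds ++ d ∷ []) ≡ arcsInto ℓ j ds + ⟦ ℓ ≤ᵇ (2 * (j + length ds) ∸ d) ⟧
arcsInto-++ ℓ j []       d = trans (+-identityʳ _) (cong (λ z → ⟦ ℓ ≤ᵇ (2 * z ∸ d) ⟧) (sym (+-identityʳ j)))
arcsInto-++ ℓ j (e ∷ ds) d rewrite arcsInto-++ ℓ (suc j) ds d | +-suc j (length ds) = sym (+-assoc ⟦ ℓ ≤ᵇ (2 * j ∸ e) ⟧ _ _)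

length-inDegs : ∀ m → length (inDegs m) ≡ m
length-inDegs zero    = refl
length-inDegs (suc m) = trans (length-++ (inDegs m)) (trans (cong (_+ 1) (length-inDegs m)) (+-comm m 1))

arcsInto-inDegs : ∀ ℓ m → arcsInto ℓ 1 (inDegs m) ≡ Σ₁ (λ j → ⟦ ℓ ≤ᵇ reach j ⟧) m
arcsInto-inDegs ℓ zero    = refl
arcsInto-inDegs ℓ (suc m) = begin
  arcsInto ℓ 1 (inDegs (suc m))                                                     ≡⟨ arcsInto-++ ℓ 1 (inDegs m) _ ⟩
  arcsInto ℓ 1 (inDegs m) + ⟦ ℓ ≤ᵇ (2 * suc (length (inDegs m)) ∸ indeg∞ (suc m)) ⟧ ≡⟨ cong₂ (λ x y → x + ⟦ ℓ ≤ᵇ (2 * suc y ∸ indeg∞ (suc m)) ⟧) (arcsInto-inDegs ℓ m) (length-inDegs m) ⟩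
  Σ₁ (λ j → ⟦ ℓ ≤ᵇ reach j ⟧) (suc m)                                               ∎
  where open ≡-Reasoning

indeg∞-suc : ∀ k → indeg∞ (suc k) ≡ Σ₁ (λ j → ⟦ suc k ≤ᵇ reach j ⟧) k
indeg∞-suc k = arcsInto-inDegs (suc k) k

-- The number of vertices before `v_(k+1)` without an arc to it, complementary to `indeg∞ (suc k)`.
shortReach : ℕ → ℕ
shortReach k = Σ₁ (λ j → ⟦ reach j ≤ᵇ k ⟧) k

indeg∞+shortReach : ∀ k → indeg∞ (suc k) + shortReach k ≡ k
indeg∞+shortReach k = begin
  indeg∞ (suc k) + shortReach k                                ≡⟨ cong (_+ shortReach k) (indeg∞-suc k) ⟩
  Σ₁ (λ j → ⟦ suc k ≤ᵇ reach j ⟧) k + shortReach k             ≡⟨ Σ₁-+ _ _ k ⟨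
  Σ₁ (λ j → ⟦ suc k ≤ᵇ reach j ⟧ + ⟦ reach j ≤ᵇ k ⟧) k         ≡⟨ Σ₁-cong k (λ j _ _ → dichotomy (reach j)) ⟩
  Σ₁ (λ _ → 1) k                                               ≡⟨ Σ₁-one k ⟩
  k                                                            ∎
  where
  open ≡-Reasoning
  dichotomy : ∀ r → ⟦ suc k ≤ᵇ r ⟧ + ⟦ r ≤ᵇ k ⟧ ≡ 1
  dichotomy r with r ≤? k
  ... | yes r≤k rewrite <⇒≤ᵇ≡false (s≤s r≤k) | ≤⇒≤ᵇ≡true r≤k = refl
  ... | no r≰k  rewrite ≤⇒≤ᵇ≡true (≰⇒> r≰k) | <⇒≤ᵇ≡false (≰⇒> r≰k) = refl

-- This form makes the strict monotonicity of reach evident.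
reach-suc : ∀ k → reach (suc k) ≡ 2 + k + shortReach k
reach-suc k = begin
  2 * suc k ∸ d                 ≡⟨ cong (_∸ d) (double k) ⟩
  2 + k + k ∸ d                 ≡⟨ cong (λ z → 2 + k + z ∸ d) (trans (+-comm (shortReach k) d) (indeg∞+shortReach k)) ⟨
  2 + k + (shortReach k + d) ∸ d ≡⟨ cong (_∸ d) (+-assoc (2 + k) (shortReach k) d) ⟨
  2 + k + shortReach k + d ∸ d  ≡⟨ m+n∸n≡m _ d ⟩
  2 + k + shortReach k          ∎
  where
  open ≡-Reasoning
  d = indeg∞ (suc k)
  double : ∀ k → 2 * suc k ≡ 2 + k + k
  double = solve-∀

shortReach-mono : ∀ k → shortReach k ≤ shortReach (suc k)
shortReach-mono k = ≤-trans (Σ₁-mono k λ j → ⟦≤ᵇ⟧-mono {reach j} m≤n⇒m≤1+n) (m≤m+n _ _)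

reach-<-suc : ∀ k → reach k < reach (suc k)
reach-<-suc zero    = s≤s z≤n
reach-<-suc (suc k) rewrite reach-suc k | reach-suc (suc k) = s≤s (s≤s (s≤s (+-monoʳ-≤ k (shortReach-mono k))))

reach-mono-< : ∀ {j k} → j < k → reach j < reach k
reach-mono-< {j} j<k = go (≤⇒≤′ j<k)
  where
  go : ∀ {k} → suc j ≤′ k → reach j < reach k
  go ≤′-refl     = reach-<-suc j
  go {suc k} (≤′-step p) = <-trans (go p) (reach-<-suc k)

k<reach : ∀ {k} → 1 ≤ k → k < reach k
k<reach {suc k} _ rewrite reach-suc k = s≤s (s≤s (m≤m+n k _))

indeg∞+reach : ∀ k → indeg∞ k + reach k ≡ 2 * k
indeg∞+reach zero    = refl
indeg∞+reach (suc k) = m+[n∸m]≡n (begin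
  indeg∞ (suc k)                  ≤⟨ m≤m+n _ (shortReach k) ⟩
  indeg∞ (suc k) + shortReach k   ≡⟨ indeg∞+shortReach k ⟩
  k                               ≤⟨ n≤1+n k ⟩
  suc k                           ≤⟨ m≤m+n (suc k) _ ⟩
  2 * suc k                       ∎)
  where open ≤-Reasoning

-- Since `reach` is strictly increasing, an arc from `v_j` to `v_k` gives one from `v_(j+1)` to
-- `v_(k+1)`; shifting by one thus injects the in-neighbours of `v_k` into those of `v_(k+1)`.
indeg∞-mono-suc : ∀ k → indeg∞ k ≤ indeg∞ (suc k)
indeg∞-mono-suc zero    = z≤n
indeg∞-mono-suc (suc k) = begin
  indeg∞ (suc k)                              ≡⟨ indeg∞-suc k ⟩
  Σ₁ (λ j → ⟦ suc k ≤ᵇ reach j ⟧) k           ≤⟨ Σ₁-mono k (λ j → ⟦≤ᵇ⟧-mono {suc k} λ le → ≤-trans (s≤s le) (reach-<-suc j)) ⟩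
  Σ₁ (λ j → ⟦ 2 + k ≤ᵇ reach (suc j) ⟧) k     ≤⟨ m≤n+m _ _ ⟩
  ⟦ 2 + k ≤ᵇ reach 1 ⟧ + Σ₁ (λ j → ⟦ 2 + k ≤ᵇ reach (suc j) ⟧) k ≡⟨ Σ₁-shift (λ j → ⟦ 2 + k ≤ᵇ reach j ⟧) k ⟨
  Σ₁ (λ j → ⟦ 2 + k ≤ᵇ reach j ⟧) (suc k)     ≡⟨ indeg∞-suc (suc k) ⟨
  indeg∞ (2 + k)                              ∎
  where open ≤-Reasoning

indeg∞-mono : ∀ {j k} → j ≤ k → indeg∞ j ≤ indeg∞ k
indeg∞-mono {j} j≤k = go (≤⇒≤′ j≤k)
  where
  go : ∀ {k} → j ≤′ k → indeg∞ j ≤ indeg∞ k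
  go ≤′-refl     = ≤-refl
  go {suc k} (≤′-step p) = ≤-trans (go p) (indeg∞-mono-suc k)

-- The even numbers from `c` to `2 * m` number at most half of `2 * suc m ∸ c`; the doubled form
-- avoids division.
count-doubles : ∀ c m → 2 * Σ₁ (λ j → ⟦ c ≤ᵇ 2 * j ⟧) m ≤ 2 * suc m ∸ c
count-doubles c zero    = z≤n
count-doubles c (suc m) with c ≤? 2 * suc m
... | yes le rewrite ≤⇒≤ᵇ≡true le = begin
  2 * (Σ₁ (λ j → ⟦ c ≤ᵇ 2 * j ⟧) m + 1)   ≡⟨ *-distribˡ-+ 2 (Σ₁ (λ j → ⟦ c ≤ᵇ 2 * j ⟧) m) 1 ⟩
  2 * Σ₁ (λ j → ⟦ c ≤ᵇ 2 * j ⟧) m + 2     ≤⟨ +-monoˡ-≤ 2 (count-doubles c m) ⟩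
  2 * suc m ∸ c + 2                       ≡⟨ +-∸-comm 2 le ⟨
  2 * suc m + 2 ∸ c                       ≡⟨ cong (_∸ c) (next m) ⟩
  2 * suc (suc m) ∸ c                     ∎
  where
  open ≤-Reasoning
  next : ∀ m → 2 * suc m + 2 ≡ 2 * suc (suc m)
  next = solve-∀
... | no ≰ rewrite <⇒≤ᵇ≡false (≰⇒> ≰) | +-identityʳ (Σ₁ (λ j → ⟦ c ≤ᵇ 2 * j ⟧) m) =
  ≤-trans (count-doubles c m) (∸-monoˡ-≤ c (*-monoʳ-≤ 2 (n≤1+n (suc m))))

-- An in-neighbour `v_j` of `v_k` satisfies `k ≤ reach j ≤ 2 * j`, so all in-neighbours lie in the
-- upper half of the indices.
2*indeg∞≤ : ∀ k → 2 * indeg∞ k ≤ k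
2*indeg∞≤ zero    = z≤n
2*indeg∞≤ (suc k) = begin
  2 * indeg∞ (suc k)                          ≡⟨ cong (2 *_) (indeg∞-suc k) ⟩
  2 * Σ₁ (λ j → ⟦ suc k ≤ᵇ reach j ⟧) k       ≤⟨ *-monoʳ-≤ 2 (Σ₁-mono k λ j → ⟦≤ᵇ⟧-mono {suc k} λ le → ≤-trans le (m∸n≤m (2 * j) (indeg∞ j))) ⟩
  2 * Σ₁ (λ j → ⟦ suc k ≤ᵇ 2 * j ⟧) k         ≤⟨ count-doubles (suc k) k ⟩
  2 * suc k ∸ suc k                           ≡⟨ m+n∸m≡n (suc k) _ ⟩
  suc k + 0                                   ≡⟨ +-identityʳ (suc k) ⟩
  suc k                                       ∎
  where open ≤-Reasoning

-- Degrees in the finite graph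

indeg≡indeg∞ : ∀ {n k} → 1 ≤ k → k ≤ n → indeg n k ≡ indeg∞ k
indeg≡indeg∞ {n} {suc k} _ k<n = begin
  indeg n (suc k)                                   ≡⟨ countᵇ-range (λ j → arcᵇ j (suc k)) n ⟩
  Σ₁ (λ j → ⟦ arcᵇ j (suc k) ⟧) n                   ≡⟨ Σ₁-truncate (<⇒≤ k<n) (λ j k<j → cong ⟦_⟧ (beyond j k<j)) ⟩
  Σ₁ (λ j → ⟦ arcᵇ j (suc k) ⟧) k                   ≡⟨ Σ₁-cong k (λ j 1≤j j≤k → cong ⟦_⟧ (within 1≤j j≤k)) ⟩
  Σ₁ (λ j → ⟦ suc k ≤ᵇ reach j ⟧) k                 ≡⟨ indeg∞-suc k ⟨
  indeg∞ (suc k)                                    ∎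
  where
  open ≡-Reasoning
  beyond : ∀ j → k < j → arcᵇ j (suc k) ≡ false
  beyond j k<j rewrite ≮⇒<ᵇ≡false k<j = Bool.∧-zeroʳ _
  within : ∀ {j} → 1 ≤ j → j ≤ k → arcᵇ j (suc k) ≡ (suc k ≤ᵇ reach j)
  within 1≤j j≤k rewrite ≤⇒≤ᵇ≡true 1≤j | <⇒<ᵇ≡true (s≤s j≤k) = refl

count-interval : ∀ a c n → Σ₁ (λ ℓ → ⟦ (a <ᵇ ℓ) ∧ (ℓ ≤ᵇ c) ⟧) n ≡ (c ⊓ n) ∸ a
count-interval a c zero    rewrite ⊓-zeroʳ c = sym (0∸n≡0 a)
count-interval a c (suc n) rewrite count-interval a c n with suc n ≤? c
... | no ≰ rewrite <⇒≤ᵇ≡false (≰⇒> ≰) | m≤n⇒m⊓n≡m (≤-pred (≰⇒> ≰)) | m≤n⇒m⊓n≡m (<⇒≤ (≰⇒> ≰)) | Bool.∧-zeroʳ (a <ᵇ suc n) = +-identityʳ _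
... | yes ≤c rewrite ≤⇒≤ᵇ≡true ≤c | m≥n⇒m⊓n≡n ≤c | m≥n⇒m⊓n≡n (<⇒≤ ≤c) with a <? suc n
...   | yes (s≤s a≤n) rewrite <⇒<ᵇ≡true (s≤s a≤n) = trans (sym (+-∸-comm 1 a≤n)) (cong (_∸ a) (+-comm n 1))
...   | no ≮ rewrite ≮⇒<ᵇ≡false (≮⇒≥ ≮) | m≤n⇒m∸n≡0 (≮⇒≥ ≮) | m≤n⇒m∸n≡0 (<⇒≤ (≮⇒≥ ≮)) = refl

outdeg≡ : ∀ n {k} → 1 ≤ k → outdeg n k ≡ (reach k ⊓ n) ∸ k
outdeg≡ n {suc k} _ = trans (countᵇ-range (arcᵇ (suc k)) n) (count-interval (suc k) (reach (suc k)) n)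

outdeg-low : ∀ {n k} → 1 ≤ k → reach k ≤ n → outdeg n k ≡ reach k ∸ k
outdeg-low {n} {k} 1≤k le = trans (outdeg≡ n 1≤k) (cong (_∸ k) (m≤n⇒m⊓n≡m le))

outdeg-high : ∀ {n k} → 1 ≤ k → n ≤ reach k → outdeg n k ≡ n ∸ k
outdeg-high {n} {k} 1≤k le = trans (outdeg≡ n 1≤k) (cong (_∸ k) (m≥n⇒m⊓n≡n le))

-- A vertex that keeps all its out-neighbours has out-degree `reach k ∸ k`, and `indeg∞ k + reach k`
-- is `2 * k`.
deg-low : ∀ {n k} → 1 ≤ k → k ≤ n → reach k ≤ n → deg n k ≡ k
deg-low {n} {k} 1≤k k≤n le = +-cancelʳ-≡ k _ _ (begin
  indeg n k + outdeg n k + k            ≡⟨ cong₂ (λ x y → x + y + k) (indeg≡indeg∞ 1≤k k≤n) (outdeg-low 1≤k le) ⟩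
  indeg∞ k + (reach k ∸ k) + k          ≡⟨ +-assoc (indeg∞ k) _ k ⟩
  indeg∞ k + (reach k ∸ k + k)          ≡⟨ cong (indeg∞ k +_) (m∸n+n≡m (<⇒≤ (k<reach 1≤k))) ⟩
  indeg∞ k + reach k                    ≡⟨ indeg∞+reach k ⟩
  k + (k + 0)                           ≡⟨ cong (k +_) (+-identityʳ k) ⟩
  k + k                                 ∎)
  where open ≡-Reasoning

-- Cutting the out-neighbours off at `n` costs `reach k ∸ n` of the full degree `k`. As `reach` is
-- strictly increasing, degrees of this kind never increase with `k`.
deg-high : ∀ {n k} → 1 ≤ k → k ≤ n → n ≤ reach k → deg n k + reach k ≡ k + n
deg-high {n} {k} 1≤k k≤n le = begin
  indeg n k + outdeg n k + reach k      ≡⟨ cong₂ (λ x y → x + y + reach k) (indeg≡indeg∞ 1≤k k≤n) (outdeg-high 1≤k le) ⟩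
  indeg∞ k + (n ∸ k) + reach k          ≡⟨ swap (indeg∞ k) (n ∸ k) (reach k) ⟩
  indeg∞ k + reach k + (n ∸ k)          ≡⟨ cong (_+ (n ∸ k)) (indeg∞+reach k) ⟩
  2 * k + (n ∸ k)                       ≡⟨ regroup k (n ∸ k) ⟩
  k + (n ∸ k + k)                       ≡⟨ cong (k +_) (m∸n+n≡m k≤n) ⟩
  k + n                                 ∎
  where
  open ≡-Reasoning
  swap : ∀ a b c → a + b + c ≡ a + c + b
  swap = solve-∀
  regroup : ∀ a b → 2 * a + b ≡ a + (b + a)
  regroup = solve-∀

≤-foldr-⊔ : ∀ {A : Set} (f : A → ℕ) {x xs} → x ∈ xs → f x ≤ foldr _⊔_ 0 (map f xs)
≤-foldr-⊔ f (here refl)      = m≤m⊔n _ _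
≤-foldr-⊔ f {xs = y ∷ _} (there x∈xs) = ≤-trans (≤-foldr-⊔ f x∈xs) (m≤n⊔m (f y) _)

deg≤Δ : ∀ {n k} → 1 ≤ k → k ≤ n → deg n k ≤ Δ n
deg≤Δ {n} {suc k} _ k<n = ≤-foldr-⊔ (deg n) (∈-map⁺ suc (∈-upTo⁺ k<n))

deg≤ : ∀ {n k} → 1 ≤ k → k ≤ n → deg n k ≤ k
deg≤ {n} {k} 1≤k k≤n with ≤-total (reach k) n
... | inj₁ le = ≤-reflexive (deg-low 1≤k k≤n le)
... | inj₂ le = +-cancelʳ-≤ (reach k) _ _ (≤-trans (≤-reflexive (deg-high 1≤k k≤n le)) (+-monoʳ-≤ k le))

-- The prime Jaconian vertex and the sign change of the degree difference

module PrimeJaconian {n i} (prime : IsPrimeJaconian n i) where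

  1≤i : 1 ≤ i
  1≤i = let p , _ = prime in p

  i≤n : i ≤ n
  i≤n = let _ , p , _ = prime in p

  -- Otherwise `v_j` would have degree `j > i`, while the maximum degree is `deg n i ≤ i`.
  reach-above : ∀ {j} → i < j → j ≤ n → n ≤ reach j
  reach-above {j} i<j j≤n with reach j ≤? n
  ... | no ≰ = <⇒≤ (≰⇒> ≰)
  ... | yes le = let _ , _ , deg≡Δ , _ = prime in ⊥-elim (<⇒≱ i<j (begin
    j         ≡⟨ deg-low 1≤j j≤n le ⟨
    deg n j   ≤⟨ deg≤Δ 1≤j j≤n ⟩
    Δ n       ≡⟨ deg≡Δ ⟨
    deg n i   ≤⟨ deg≤ 1≤i i≤n ⟩
    i         ∎))
    where
    open ≤-Reasoning
    1≤j = ≤-trans 1≤i (<⇒≤ i<j)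

  -- The hypotheses on `j` provide a predecessor `v_q` of `v_i`. If `n < reach i`, the degree of
  -- `v_q` would be at least that of `v_i`, against the choice of `i` as the smallest index of
  -- maximum degree.
  reach-below : ∀ {j} → 1 ≤ j → j < i → reach i ≤ n
  reach-below {j} 1≤j (s≤s {n = q} j≤q) with reach i ≤? n
  ... | yes le = le
  ... | no ≰ = let _ , _ , deg≡Δ , first = prime in
    ⊥-elim (first q 1≤q ≤-refl (≤-antisym (deg≤Δ 1≤q q≤n) (≤-trans (≤-reflexive (sym deg≡Δ)) deg-i≤deg-q)))
    where
    open ≤-Reasoning
    1≤q = ≤-trans 1≤j j≤q
    q≤n = ≤-trans (n≤1+n q) i≤n
    n<reach = ≰⇒> ≰
    deg-i≤deg-q : deg n (suc q) ≤ deg n q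
    deg-i≤deg-q with ≤-total (reach q) n
    ... | inj₁ le = ≤-trans (+-cancelʳ-≤ (suc n) _ _ (begin
      deg n (suc q) + suc n             ≤⟨ +-monoʳ-≤ (deg n (suc q)) n<reach ⟩
      deg n (suc q) + reach (suc q)     ≡⟨ deg-high 1≤i i≤n (<⇒≤ n<reach) ⟩
      suc q + n                         ≡⟨ +-suc q n ⟨
      q + suc n                         ∎)) (≤-reflexive (sym (deg-low 1≤q q≤n le)))
    ... | inj₂ le = +-cancelʳ-≤ (suc (reach q)) _ _ (begin
      deg n (suc q) + suc (reach q)     ≤⟨ +-monoʳ-≤ (deg n (suc q)) (reach-<-suc q) ⟩
      deg n (suc q) + reach (suc q)     ≡⟨ deg-high 1≤i i≤n (<⇒≤ n<reach) ⟩
      suc (q + n)                       ≡⟨ cong suc (deg-high 1≤q q≤n le) ⟨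
      suc (deg n q + reach q)           ≡⟨ +-suc (deg n q) (reach q) ⟨
      deg n q + suc (reach q)           ∎)

  -- With no out-neighbour cut off the degree is `j`, and by `2*indeg∞≤` at most half of it is
  -- in-degree.
  reach≤n⇒indeg≤outdeg : ∀ {j} → 1 ≤ j → j ≤ n → reach j ≤ n → indeg n j ≤ outdeg n j
  reach≤n⇒indeg≤outdeg {j} 1≤j j≤n le rewrite indeg≡indeg∞ 1≤j j≤n | outdeg-low 1≤j le =
    m+n≤o⇒m≤o∸n (indeg∞ j) (+-cancelˡ-≤ (indeg∞ j) _ _ (begin
      indeg∞ j + (indeg∞ j + j)   ≡⟨ regroup (indeg∞ j) j ⟩
      2 * indeg∞ j + j            ≤⟨ +-monoˡ-≤ j (2*indeg∞≤ j) ⟩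
      j + j                       ≡⟨ cong (j +_) (+-identityʳ j) ⟨
      2 * j                       ≡⟨ indeg∞+reach j ⟨
      indeg∞ j + reach j          ∎))
    where
    open ≤-Reasoning
    regroup : ∀ a b → a + (a + b) ≡ 2 * a + b
    regroup = solve-∀

  indeg≤outdeg : ∀ {j} → 1 ≤ j → j ≤ i → indeg n j ≤ outdeg n j
  indeg≤outdeg {j} 1≤j j≤i with m≤n⇒m<n∨m≡n j≤i
  ... | inj₁ j<i  = reach≤n⇒indeg≤outdeg 1≤j (≤-trans j≤i i≤n)
                      (≤-trans (<⇒≤ (reach-mono-< j<i)) (reach-below 1≤j j<i))
  ... | inj₂ refl with m≤n⇒m<n∨m≡n 1≤i
  ...   | inj₁ 1<i  = reach≤n⇒indeg≤outdeg 1≤j i≤n (reach-below ≤-refl 1<i)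
  -- Here `i = 1`, where `reach i ≤ n` can fail: `reach 1` is 2, which exceeds `n = 1`. The
  -- in-degree of `v_1` is zero in any case.
  ...   | inj₂ refl rewrite indeg≡indeg∞ 1≤i i≤n = z≤n

  outdeg-above : ∀ {j} → i < j → j ≤ n → outdeg n j ≡ n ∸ j
  outdeg-above i<j j≤n = outdeg-high (≤-trans 1≤i (<⇒≤ i<j)) (reach-above i<j j≤n)

  -- Cutting after `v_t` gives the extremal set for the lower bound. By `i≤t`, every vertex after
  -- `v_t` reaches `v_n`, so these vertices form a clique.
  record Turn : Set where
    field
      t        : ℕ
      i≤t      : i ≤ t
      t≤n      : t ≤ n
      at-t     : indeg n t ≤ outdeg n t
      after-t  : ∀ {j} → t < j → j ≤ n → outdeg n j ≤ indeg n j

  turn : Turn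
  turn = search n i≤n ≤-refl λ n<j j≤n → ⊥-elim (<⇒≱ n<j j≤n)
    where
    -- The search runs downwards from `n` and stops at `i` at the latest, where `indeg≤outdeg`
    -- applies.
    search : ∀ m → i ≤ m → m ≤ n → (∀ {j} → m < j → j ≤ n → outdeg n j ≤ indeg n j) → Turn
    search m i≤m m≤n after with indeg n m ≤? outdeg n m
    ... | yes le = record { t = m ; i≤t = i≤m ; t≤n = m≤n ; at-t = le ; after-t = after }
    ... | no ≰ with m≤n⇒m<n∨m≡n i≤m
    ...   | inj₂ refl = ⊥-elim (≰ (indeg≤outdeg 1≤i ≤-refl))
    search (suc m) i≤m m≤n after | no ≰ | inj₁ (s≤s i≤m′) = search m i≤m′ (<⇒≤ m≤n) after′
      where
      after′ : ∀ {j} → m < j → j ≤ n → outdeg n j ≤ indeg n j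
      after′ m<j j≤n with m≤n⇒m<n∨m≡n m<j
      ... | inj₁ lt   = after lt j≤n
      ... | inj₂ refl = <⇒≤ (≰⇒> ≰)

  open Turn turn public

  -- Beyond `i` the in-degree is nondecreasing and the out-degree `n ∸ j` is nonincreasing, so the
  -- inequality at `t` passes down to every `j` between `i` and `t`.
  up-to-t : ∀ {j} → 1 ≤ j → j ≤ t → indeg n j ≤ outdeg n j
  up-to-t {j} 1≤j j≤t with j ≤? i
  ... | yes j≤i = indeg≤outdeg 1≤j j≤i
  ... | no j≰i  = begin
    indeg n j   ≡⟨ indeg≡indeg∞ 1≤j (≤-trans j≤t t≤n) ⟩
    indeg∞ j    ≤⟨ indeg∞-mono j≤t ⟩
    indeg∞ t    ≡⟨ indeg≡indeg∞ (≤-trans 1≤j j≤t) t≤n ⟨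
    indeg n t   ≤⟨ at-t ⟩
    outdeg n t  ≡⟨ outdeg-above (<-≤-trans i<j j≤t) t≤n ⟩
    n ∸ t       ≤⟨ ∸-monoʳ-≤ n j≤t ⟩
    n ∸ j       ≡⟨ outdeg-above i<j (≤-trans j≤t t≤n) ⟨
    outdeg n j  ∎
    where
    open ≤-Reasoning
    i<j = ≰⇒> j≰i

∑-toℕ : ∀ f n → ∑ {n} (λ x → f (suc (toℕ x))) ≡ Σ₁ f n
∑-toℕ f zero    = refl
∑-toℕ f (suc n) = trans (cong (λ z → f 1 + z) (∑-toℕ (f ∘ suc) n)) (sym (Σ₁-shift f n))

arcᵇ-true : ∀ {k ℓ} → 1 ≤ k → k < ℓ → ℓ ≤ reach k → arcᵇ k ℓ ≡ true
arcᵇ-true 1≤k k<ℓ ℓ≤ rewrite ≤⇒≤ᵇ≡true 1≤k | <⇒<ᵇ≡true k<ℓ = ≤⇒≤ᵇ≡true ℓ≤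

arcᵇ-≥ : ∀ {k ℓ} → ℓ ≤ k → arcᵇ k ℓ ≡ false
arcᵇ-≥ ℓ≤k rewrite ≮⇒<ᵇ≡false ℓ≤k = Bool.∧-zeroʳ _

arcᵇ⇒reach : ∀ k ℓ → arcᵇ k ℓ ≡ true → ℓ ≤ reach k
arcᵇ⇒reach k ℓ arc with ℓ ≤? reach k
... | yes le = le
... | no ≰ rewrite <⇒≤ᵇ≡false (≰⇒> ≰) | Bool.∧-zeroʳ (k <ᵇ ℓ) | Bool.∧-zeroʳ (1 ≤ᵇ k) with () ← arc

-- Truncated subtraction makes this the maximum of 0 and `d⁺ - d⁻`.
excess : ℕ → ℕ → ℕ
excess n j = outdeg n j ∸ indeg n j

-- The brush number of J_n(1)

module _ (n : ℕ) where

  arc : Fin n → Fin n → Bool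
  arc x y = arcᵇ (suc (toℕ x)) (suc (toℕ y))

  out in′ : Fin n → ℕ
  out x = outdeg n (suc (toℕ x))
  in′ x = indeg n (suc (toℕ x))

  arc-≥ : ∀ x y → toℕ y ≤ toℕ x → arc x y ≡ false
  arc-≥ x y y≤x = arcᵇ-≥ (s≤s y≤x)

  Jaco-irrefl : ∀ x → adj (Jaco n) x x ≡ false
  Jaco-irrefl x rewrite arc-≥ x x ≤-refl = refl

  Jaco-sym : ∀ x y → adj (Jaco n) x y ≡ adj (Jaco n) y x
  Jaco-sym x y = Bool.∨-comm (arc x y) (arc y x)

  out-∑ : ∀ x → out x ≡ ∑ (λ y → ⟦ arc x y ⟧)
  out-∑ x = trans (countᵇ-range (arcᵇ (suc (toℕ x))) n) (sym (∑-toℕ (λ ℓ → ⟦ arcᵇ (suc (toℕ x)) ℓ ⟧) n))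

  in-∑ : ∀ x → in′ x ≡ ∑ (λ y → ⟦ arc y x ⟧)
  in-∑ x = trans (countᵇ-range (λ k → arcᵇ k (suc (toℕ x))) n) (sym (∑-toℕ (λ k → ⟦ arcᵇ k (suc (toℕ x)) ⟧) n))

  forward : ∀ x y → adj (Jaco n) x y ∧ not (toℕ y <ᵇ toℕ x) ≡ arc x y
  forward x y with toℕ y <? toℕ x
  ... | yes y<x rewrite <⇒<ᵇ≡true y<x | arc-≥ x y (<⇒≤ y<x) = Bool.∧-zeroʳ _
  ... | no y≮x rewrite ≮⇒<ᵇ≡false (≮⇒≥ y≮x) =
    trans (Bool.∧-identityʳ _) (Bool.∨-identityʳ _)

  backward : ∀ x y → (toℕ y <ᵇ toℕ x) ∧ adj (Jaco n) y x ≡ arc y x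
  backward x y with toℕ y <? toℕ x
  ... | yes y<x rewrite <⇒<ᵇ≡true y<x | arc-≥ x y (<⇒≤ y<x) = Bool.∨-identityʳ _
  ... | no y≮x rewrite ≮⇒<ᵇ≡false (≮⇒≥ y≮x) = refl

  open Cleaning (Jaco n) Jaco-irrefl

  allocation : Fin n → ℕ
  allocation x = excess n (suc (toℕ x))

  allocation-cleans : Cleans (Jaco n) allocation
  allocation-cleans = supply⇒Cleans allocation λ v → begin
    ∑ (λ w → ⟦ adj (Jaco n) v w ∧ not (toℕ w <ᵇ toℕ v) ⟧)               ≡⟨ sum-cong-≗ (λ w → cong ⟦_⟧ (forward v w)) ⟩
    ∑ (λ w → ⟦ arc v w ⟧)                                               ≡⟨ out-∑ v ⟨
    out v                                                               ≤⟨ m≤n+m∸n (out v) (in′ v) ⟩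
    in′ v + allocation v                                                ≡⟨ +-comm (in′ v) _ ⟩
    allocation v + in′ v                                                ≡⟨ cong (λ z → allocation v + z) (in-∑ v) ⟩
    allocation v + ∑ (λ u → ⟦ arc u v ⟧)                                ≡⟨ cong (λ z → allocation v + z) (sum-cong-≗ λ u → cong ⟦_⟧ (backward v u)) ⟨
    allocation v + ∑ (λ u → ⟦ (toℕ u <ᵇ toℕ v) ∧ adj (Jaco n) u v ⟧)    ∎
    where open ≤-Reasoning

  -- As the index `x` stands for `v_(x+1)`, this is the set of `v_1` to `v_t`.
  below : ℕ → VertexSet
  below t x = toℕ x <ᵇ t

  below-closed : ∀ {t x y} → below t x ≡ true → below t y ≡ false → arc y x ≡ false
  below-closed {t} {x} {y} x<t y≮t =
    arc-≥ y x (≤-trans (<⇒≤ (<ᵇ≡true⇒< (toℕ x) t x<t)) (<ᵇ≡false⇒≥ (toℕ y) t y≮t))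

  internal : ℕ → Fin n → Fin n → ℕ
  internal t x y = ⟦ below t x ∧ below t y ∧ arc x y ⟧

  -- An arc from a vertex below `t` stays below `t` or crosses the cut, while an arc into such a
  -- vertex also starts below `t`. Together with `in-below`, this makes the cut the sum of
  -- `out - in′` below `t`.
  out-below : ∀ t → ∑ (λ x → ⟦ below t x ⟧ * out x) ≡ ∑ (λ x → ∑ (internal t x)) + cut (below t)
  out-below t = begin
    ∑ (λ x → ⟦ below t x ⟧ * out x)                        ≡⟨ sum-cong-≗ (λ x → trans (cong (⟦ below t x ⟧ *_) (out-∑ x)) (*-distribˡ-sum ⟦ below t x ⟧ (λ y → ⟦ arc x y ⟧))) ⟩
    ∑ (λ x → ∑ (λ y → ⟦ below t x ⟧ * ⟦ arc x y ⟧))        ≡⟨ sum-cong-≗ (λ x → sum-cong-≗ (split x)) ⟩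
    ∑ (λ x → ∑ (λ y → internal t x y + ⟦ below t x ∧ not (below t y) ∧ adj (Jaco n) x y ⟧))
      ≡⟨ ∑∑-distrib-+ (internal t) (λ x y → ⟦ below t x ∧ not (below t y) ∧ adj (Jaco n) x y ⟧) ⟩
    ∑ (λ x → ∑ (internal t x)) + cut (below t)             ∎
    where
    open ≡-Reasoning
    split : ∀ x y → ⟦ below t x ⟧ * ⟦ arc x y ⟧ ≡ internal t x y + ⟦ below t x ∧ not (below t y) ∧ adj (Jaco n) x y ⟧
    split x y with below t x in x<t | below t y in y<t
    ... | false | _     = refl
    ... | true  | true  = refl
    ... | true  | false rewrite below-closed {t} {x} {y} x<t y<t with arc x y
    ...   | true  = refl
    ...   | false = refl

  in-below : ∀ t → ∑ (λ x → ⟦ below t x ⟧ * in′ x) ≡ ∑ (λ x → ∑ (internal t x))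
  in-below t = begin
    ∑ (λ x → ⟦ below t x ⟧ * in′ x)                        ≡⟨ sum-cong-≗ (λ x → trans (cong (⟦ below t x ⟧ *_) (in-∑ x)) (*-distribˡ-sum ⟦ below t x ⟧ (λ y → ⟦ arc y x ⟧))) ⟩
    ∑ (λ x → ∑ (λ y → ⟦ below t x ⟧ * ⟦ arc y x ⟧))        ≡⟨ sum-cong-≗ (λ x → sum-cong-≗ (stay x)) ⟩
    ∑ (λ x → ∑ (λ y → internal t y x))                     ≡⟨ ∑-comm (λ x y → internal t y x) ⟩
    ∑ (λ x → ∑ (internal t x))                             ∎
    where
    open ≡-Reasoning
    stay : ∀ x y → ⟦ below t x ⟧ * ⟦ arc y x ⟧ ≡ internal t y x
    stay x y with below t x in x<t | below t y in y<t
    ... | false | false = refl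
    ... | false | true  = refl
    ... | true  | true  = +-identityʳ _
    ... | true  | false rewrite below-closed {t} {x} {y} x<t y<t = refl

  -- The cut after the sign change and the lower bound

  module _ {i} (prime : IsPrimeJaconian n i) where
    open PrimeJaconian prime

    -- The sign change at `t` makes the allocation equal to `out - in′` below `t` and to zero
    -- elsewhere. Adding the in-degrees below `t` to both sides keeps the computation in `ℕ`.
    allocation≡cut : ∑ allocation ≡ cut (below t)
    allocation≡cut = +-cancelʳ-≡ (∑ (λ x → ⟦ below t x ⟧ * in′ x)) _ _ (begin
      ∑ allocation + ∑ (λ x → ⟦ below t x ⟧ * in′ x)       ≡⟨ ∑-distrib-+ allocation _ ⟨
      ∑ (λ x → allocation x + ⟦ below t x ⟧ * in′ x)       ≡⟨ sum-cong-≗ signs ⟩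
      ∑ (λ x → ⟦ below t x ⟧ * out x)                      ≡⟨ out-below t ⟩
      ∑ (λ x → ∑ (internal t x)) + cut (below t)           ≡⟨ +-comm _ (cut (below t)) ⟩
      cut (below t) + ∑ (λ x → ∑ (internal t x))           ≡⟨ cong (λ z → cut (below t) + z) (in-below t) ⟨
      cut (below t) + ∑ (λ x → ⟦ below t x ⟧ * in′ x)      ∎)
      where
      open ≡-Reasoning
      signs : ∀ x → allocation x + ⟦ below t x ⟧ * in′ x ≡ ⟦ below t x ⟧ * out x
      signs x with below t x in x<t
      ... | true  = trans (cong (λ z → allocation x + z) (+-identityʳ (in′ x)))
                      (trans (m∸n+n≡m (up-to-t (s≤s z≤n) (<ᵇ≡true⇒< (toℕ x) t x<t))) (sym (+-identityʳ (out x))))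
      ... | false = trans (+-identityʳ (allocation x)) (m≤n⇒m∸n≡0 (after-t (s≤s (<ᵇ≡false⇒≥ (toℕ x) t x<t)) (toℕ<n x)))

    window : VertexSet
    window x = t ≤ᵇ reach (suc (toℕ x))

    window⇒reach : ∀ {x} → window x ≡ true → t ≤ reach (suc (toℕ x))
    window⇒reach {x} eq = ≤ᵇ⇒≤ t _ (Equivalence.from Bool.T-≡ eq)

    -- If both vertices are below `t`, the target has index at most `t`, within the reach of any
    -- window vertex. If neither is, the source reaches `v_n` by `reach-above`.
    window-arc : ∀ {x y} → toℕ x < toℕ y → window x ≡ true → below t x ≡ below t y → arc x y ≡ true
    window-arc {x} {y} x<y x∈W same with below t x in x<t
    ... | true  = arcᵇ-true (s≤s z≤n) (s≤s x<y) (≤-trans (<ᵇ≡true⇒< (toℕ y) t (sym same)) (window⇒reach {x} x∈W))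
    ... | false = arcᵇ-true (s≤s z≤n) (s≤s x<y) (≤-trans (toℕ<n y)
                    (reach-above (s≤s (≤-trans i≤t (<ᵇ≡false⇒≥ (toℕ x) t x<t))) (toℕ<n x)))

    window-cliques : ∀ {x y} → x ≢ y → window x ≡ true → window y ≡ true → below t x ≡ below t y → adj (Jaco n) x y ≡ true
    window-cliques {x} {y} x≢y x∈W y∈W same with <-cmp (toℕ x) (toℕ y)
    ... | tri< x<y _ _ = cong (_∨ arc y x) (window-arc {x} {y} x<y x∈W same)
    ... | tri≈ _ x≡y _ = ⊥-elim (x≢y (toℕ-injective x≡y))
    ... | tri> _ _ y<x = trans (Jaco-sym x y) (cong (_∨ arc x y) (window-arc {y} {x} y<x y∈W (sym same)))

    window-beyond : ∀ {x} → below t x ≡ false → window x ≡ true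
    window-beyond {x} x≮t = ≤⇒≤ᵇ≡true (≤-trans (<ᵇ≡false⇒≥ (toℕ x) t x≮t) (<⇒≤ (<-trans (n<1+n _) (k<reach (s≤s z≤n)))))

    window-boundary : ∀ {x y} → below t x ≡ true → below t y ≡ false → adj (Jaco n) x y ≡ true → window x ≡ true
    window-boundary {x} {y} x<t y≮t xy = ≤⇒≤ᵇ≡true (≤-trans (m≤n⇒m≤1+n (<ᵇ≡false⇒≥ (toℕ y) t y≮t)) (arcᵇ⇒reach (suc (toℕ x)) (suc (toℕ y)) xy-arc))
      where
      xy-arc : arc x y ≡ true
      xy-arc = trans (sym (trans (cong (arc x y ∨_) (below-closed {t} {x} {y} x<t y≮t)) (Bool.∨-identityʳ _))) xy

    -- The threshold is the number of vertices after `v_t`; they all lie in `window`, so it does not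
    -- exceed the size of the window.
    Cleans⇒allocation≤ : ∀ b → Cleans (Jaco n) b → ∑ allocation ≤ ∑ b
    Cleans⇒allocation≤ b = Cleans⇒≥ window (∑ (λ x → ⟦ not (below t x) ⟧)) (∑-mono larger) (∑ allocation)
      λ F eq → subst (_≤ cut F) (sym allocation≡cut)
        (cut-minimal Jaco-sym window (below t) window-cliques (λ {x} → window-beyond {x}) (λ {x} {y} → window-boundary {x} {y}) F eq)
      where
      larger : ∀ x → ⟦ not (below t x) ⟧ ≤ ⟦ window x ⟧
      larger x with below t x in x<t
      ... | true  = z≤n
      ... | false = ≤-reflexive (sym (cong ⟦_⟧ (window-beyond {x} x<t)))

-- The formula over the integers

open import Data.Integer as ℤ using (+_)
import Data.Integer.Properties as ℤ

-- The partial sum `Σ₁ h a` in front lets the two sums of the formula be joined end to end, the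
-- second starting from the value of the first.
sumℤ-rangeFrom : ∀ {g h} a m → (∀ j → a < j → j ≤ a + m → g j ≡ + h j) →
  + Σ₁ h a ℤ.+ sumℤ (map g (rangeFrom a m)) ≡ + Σ₁ h (a + m)
sumℤ-rangeFrom {h = h} a zero g≡h = trans (ℤ.+-identityʳ _) (cong (λ z → + Σ₁ h z) (sym (+-identityʳ a)))
sumℤ-rangeFrom {g} {h} a (suc m) g≡h = begin
  + Σ₁ h a ℤ.+ sumℤ (map g (rangeFrom a (suc m)))              ≡⟨ cong (λ xs → + Σ₁ h a ℤ.+ sumℤ (map g xs)) (rangeFrom-suc a m) ⟩
  + Σ₁ h a ℤ.+ (g (suc a) ℤ.+ sumℤ (map g (rangeFrom (suc a) m)))  ≡⟨ ℤ.+-assoc (+ Σ₁ h a) (g (suc a)) _ ⟨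
  + Σ₁ h a ℤ.+ g (suc a) ℤ.+ sumℤ (map g (rangeFrom (suc a) m))    ≡⟨ cong (λ z → + Σ₁ h a ℤ.+ z ℤ.+ sumℤ (map g (rangeFrom (suc a) m))) (g≡h (suc a) ≤-refl (subst (suc a ≤_) (sym (+-suc a m)) (s≤s (m≤m+n a m)))) ⟩
  + Σ₁ h (suc a) ℤ.+ sumℤ (map g (rangeFrom (suc a) m))        ≡⟨ sumℤ-rangeFrom (suc a) m (λ j a<j j≤ → g≡h j (<⇒≤ a<j) (subst (j ≤_) (sym (+-suc a m)) j≤)) ⟩
  + Σ₁ h (suc a + m)                                           ≡⟨ cong (λ z → + Σ₁ h z) (+-suc a m) ⟨
  + Σ₁ h (a + suc m)                                           ∎
  where open ≡-Reasoning

+-+≡+∸ : ∀ {m n} → n ≤ m → + m ℤ.- + n ≡ + (m ∸ n)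
+-+≡+∸ {m} {n} n≤m = trans (ℤ.m-n≡m⊖n m n) (ℤ.⊖-≥ n≤m)

0⊔-≡∸ : ∀ m n → + 0 ℤ.⊔ (+ m ℤ.- + n) ≡ + (m ∸ n)
0⊔-≡∸ m n with ≤-total n m
... | inj₁ n≤m = cong (+ 0 ℤ.⊔_) (+-+≡+∸ n≤m)
... | inj₂ m≤n = trans (ℤ.i≥j⇒i⊔j≡i (ℤ.i≤j⇒i-j≤0 (ℤ.+≤+ m≤n))) (cong +_ (sym (m≤n⇒m∸n≡0 m≤n)))

-- Up to `i`, `indeg≤outdeg` makes each difference equal to its truncation; beyond `i`,
-- `outdeg-above` identifies `n - j` with the out-degree. Both sums therefore run over `excess n`.
brushFormula≡ : ∀ {n i} → IsPrimeJaconian n i → brushFormula n i ≡ + Σ₁ (excess n) n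
brushFormula≡ {n} {i} prime = begin
  brushFormula n i
    ≡⟨ cong (ℤ._+ sumℤ (map (λ j → (+ 0) ℤ.⊔ ((+ n ℤ.- + j) ℤ.- + indeg n j)) (rangeFrom i (n ∸ i))))
         (trans (sym (ℤ.+-identityˡ (sumℤ (map (λ j → + outdeg n j ℤ.- + indeg n j) (range i)))))
                (sumℤ-rangeFrom 0 i λ j 1≤j j≤i → +-+≡+∸ (indeg≤outdeg 1≤j j≤i))) ⟩
  + Σ₁ (excess n) i ℤ.+ sumℤ (map (λ j → (+ 0) ℤ.⊔ ((+ n ℤ.- + j) ℤ.- + indeg n j)) (rangeFrom i (n ∸ i)))
    ≡⟨ sumℤ-rangeFrom i (n ∸ i) (λ j i<j j≤ → above j i<j (subst (j ≤_) (m+[n∸m]≡n i≤n) j≤)) ⟩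
  + Σ₁ (excess n) (i + (n ∸ i))
    ≡⟨ cong (λ z → + Σ₁ (excess n) z) (m+[n∸m]≡n i≤n) ⟩
  + Σ₁ (excess n) n ∎
  where
  open ≡-Reasoning
  open PrimeJaconian prime
  above : ∀ j → i < j → j ≤ n → (+ 0) ℤ.⊔ ((+ n ℤ.- + j) ℤ.- + indeg n j) ≡ + excess n j
  above j i<j j≤n = begin
    (+ 0) ℤ.⊔ ((+ n ℤ.- + j) ℤ.- + indeg n j)   ≡⟨ cong (λ z → (+ 0) ℤ.⊔ (z ℤ.- + indeg n j)) (+-+≡+∸ j≤n) ⟩
    (+ 0) ℤ.⊔ (+ (n ∸ j) ℤ.- + indeg n j)       ≡⟨ 0⊔-≡∸ (n ∸ j) (indeg n j) ⟩
    + (n ∸ j ∸ indeg n j)                       ≡⟨ cong (λ z → + (z ∸ indeg n j)) (outdeg-above i<j j≤n) ⟨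
    + excess n j                                ∎

theorem2p1 : (n i : ℕ) → IsPrimeJaconian n i →
    ∃ λ k → IsBrushNumber (Jaco n) k × (+ k ≡ brushFormula n i)
theorem2p1 n i prime = totalBrushes (Jaco n) (allocation n) ,
  ((allocation n , allocation-cleans n , refl) ,
   (λ b cleans → subst₂ _≤_ (sym (totalBrushes-∑ (Jaco n) (allocation n))) (sym (totalBrushes-∑ (Jaco n) b))
                   (Cleans⇒allocation≤ n prime b cleans))) ,
  sym (trans (brushFormula≡ prime)
        (cong +_ (sym (trans (totalBrushes-∑ (Jaco n) (allocation n)) (∑-toℕ (excess n) n)))))
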